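{- There exists a $2$-$(694,7,2)$ design.
   Context: A $2$-$(v,k,\lambda)$ design is a pair $(V,\mathcal{A})$ where $V$ is a set of $v$ points and $\mathcal{A}$ is a collection (multiset) of $k$-subsets of $V$ (blocks) such that every $2$-subset of $V$ is contained in exactly $\lambda$ blocks of $\mathcal{A}$. -}

module Defs where

open import Data.Nat using (ℕ)
open import Data.Fin using (Fin)
open import Data.Fin.Subset using (Subset; _∈_; ∣_∣)
open import Data.Fin.Subset.Properties using (_∈?_)
open import Data.List using (List; length; filter)
open import Data.List.Relation.Unary.All using (All)
open import Data.Product using (_×_)
open import Relation.Binary.PropositionalEquality using (_≡_)
open import Relation.Nullary using (¬_)
open import Relation.Nullary.Decidable using (_×-dec_)

pairCount : {v : ℕ} → List (Subset v) → Fin v → Fin v → ℕ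
pairCount 𝒜 x y = length (filter (λ B → (x ∈? B) ×-dec (y ∈? B)) 𝒜)

record Design2 (v k λ' : ℕ) : Set where
  field
    blocks     : List (Subset v)
    blockSize  : All (λ B → ∣ B ∣ ≡ k) blocks
    balanced   : (x y : Fin v) → ¬ (x ≡ y) → pairCount blocks x y ≡ λ'

{-# OPTIONS --safe #-}

-- The points are ∞ and the elements of G = ℤ₁₁ × ℤ₆₃ ≅ ℤ₆₉₃.  The eleven cosets of the subgroup of
-- order 63, each together with ∞, carry copies of a cyclic 2-(64,7,2) design.  The pairs of points in
-- different cosets are covered by the translates of 30 base blocks of G, which are obtained from three
-- multisets of size 7 whose ordered differences cover every element of ℤ₆₃, zero included, exactly
-- twice: a multiset [b₀,…,b₆] yields the base blocks {(u·i , bᵢ) : 0 ≤ i ≤ 6}, one for every unit u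
-- of ℤ₁₁.  A difference (u(i − j) , bᵢ − bⱼ) then takes every nonzero first coordinate exactly once
-- as u varies.
module Submission where

open import Defs

open import Algebra.Bundles using (AbelianGroup)
import Algebra.Properties.AbelianGroup as AbelianGroupProperties
import Algebra.Properties.CommutativeSemigroup as CommutativeSemigroupProperties
import Algebra.Properties.Group as GroupProperties
open import Algebra.Structures using (IsAbelianGroup)
open import Data.Bool using (Bool; true; false; if_then_else_; _∧_)
open import Data.Fin using (Fin; zero; suc; toℕ; combine)
open import Data.Fin.Instances
open import Data.Fin.Properties
  using (toℕ<n; toℕ-fromℕ<; toℕ-injective; toℕ-combine; combine-injectiveˡ; combine-injectiveʳ;
         combine-surjective; suc-injective)
import Data.Fin.Subset as Subset
import Data.Fin.Subset.Properties as Subset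
open import Data.List using (List; []; _∷_; _++_; map; concatMap; zipWith; allFin; upTo; length; filter)
open import Data.List.Properties using (map-cong; map-∘; map-++; map-tabulate; length-map)
import Data.List.Membership.DecPropositional as DecMembership
open import Data.List.Membership.Propositional using (_∈_; _∉_)
open import Data.List.Membership.Propositional.Properties using (∈-upTo⁺)
open import Data.List.Relation.Unary.All as All using (All; []; _∷_; all?)
import Data.List.Relation.Unary.All.Properties as All
open import Data.List.Relation.Unary.AllPairs using ([]; _∷_)
open import Data.List.Relation.Unary.Any using (here; there)
open import Data.List.Relation.Unary.Unique.DecPropositional using (unique?)
open import Data.List.Relation.Unary.Unique.Propositional using (Unique)
import Data.List.Relation.Unary.Unique.Propositional.Properties as Unique
open import Data.Nat using (ℕ; zero; suc; _+_; _*_; NonZero)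
open import Data.Nat.Divisibility using (_∣_; divides; ∣m⇒∣m*n; m∣m*n)
open import Data.Nat.DivMod
  using (_%_; _mod_; m%n<n; m<n⇒m%n≡m; m%n%n≡m%n; %-distribˡ-+; m*n%n≡0;
         %-remove-+ˡ; %-remove-+ʳ; m∣n⇒o%n%m≡o%m)
open import Data.Nat.Instances
open import Data.Nat.ListAction using (sum)
open import Data.Nat.ListAction.Properties using (sum-++)
open import Data.Nat.Properties
  using (+-assoc; +-comm; +-identityʳ; *-comm; *-zeroʳ; *-distribʳ-+; *-distribˡ-+;
         +-commutativeSemigroup)
open import Data.Product using (_×_; _,_)
import Data.Vec as Vec
import Data.Vec.Properties as Vec
open import Function using (_∘_; id; const; Injective)
open import Relation.Binary.PropositionalEquality
open import Relation.Binary.Structures using (IsDecEquivalence)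
open import Relation.Binary.TypeClasses using (_≟_)
open import Relation.Nullary using (Dec; yes; no; does; contradiction)
open import Relation.Nullary.Decidable using (dec-true; dec-false; from-yes; _×-dec_)
open import Relation.Unary using (Decidable)

open ≡-Reasoning
open CommutativeSemigroupProperties +-commutativeSemigroup using (interchange)

private
  variable
    A B : Set
    n v k l : ℕ

DecEq : Set → Set
DecEq A = IsDecEquivalence {A = A} _≡_

-- Finite sums

∑ : List A → (A → ℕ) → ℕ
∑ xs f = sum (map f xs)

module _ {f g : A → ℕ} where

  ∑-cong : (∀ x → f x ≡ g x) → (xs : List A) → ∑ xs f ≡ ∑ xs g
  ∑-cong f≗g xs = cong sum (map-cong f≗g xs)

  ∑-+ : (xs : List A) → ∑ xs (λ x → f x + g x) ≡ ∑ xs f + ∑ xs g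
  ∑-+ []       = refl
  ∑-+ (x ∷ xs) = trans (cong (f x + g x +_) (∑-+ xs)) (interchange (f x) (g x) _ _)

∑-map : (h : A → B) (xs : List A) {f : B → ℕ} → ∑ (map h xs) f ≡ ∑ xs (f ∘ h)
∑-map h xs = cong sum (sym (map-∘ xs))

∑-++ : (xs ys : List A) {f : A → ℕ} → ∑ (xs ++ ys) f ≡ ∑ xs f + ∑ ys f
∑-++ xs ys {f} = trans (cong sum (map-++ f xs ys)) (sum-++ (map f xs) (map f ys))

∑-concatMap : (h : A → List B) (xs : List A) {f : B → ℕ} →
              ∑ (concatMap h xs) f ≡ ∑ xs (λ x → ∑ (h x) f)
∑-concatMap h []       = refl
∑-concatMap h (x ∷ xs) = trans (∑-++ (h x) (concatMap h xs)) (cong (∑ (h x) _ +_) (∑-concatMap h xs))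

∑-zero : (xs : List A) {f : A → ℕ} → (∀ x → f x ≡ 0) → ∑ xs f ≡ 0
∑-zero []       f≗0 = refl
∑-zero (x ∷ xs) f≗0 = cong₂ _+_ (f≗0 x) (∑-zero xs f≗0)

∑-const-1 : (xs : List A) → ∑ xs (const 1) ≡ length xs
∑-const-1 []       = refl
∑-const-1 (_ ∷ xs) = cong suc (∑-const-1 xs)

∑-swap : (xs : List A) (ys : List B) {f : A → B → ℕ} →
         ∑ xs (λ x → ∑ ys (f x)) ≡ ∑ ys (λ y → ∑ xs (λ x → f x y))
∑-swap []       ys = sym (∑-zero ys (λ _ → refl))
∑-swap (x ∷ xs) ys = trans (cong (∑ ys _ +_) (∑-swap xs ys)) (sym (∑-+ ys))

*-distribˡ-∑ : (c : ℕ) (xs : List A) {f : A → ℕ} → c * ∑ xs f ≡ ∑ xs (λ x → c * f x)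
*-distribˡ-∑ c []           = *-zeroʳ c
*-distribˡ-∑ c (x ∷ xs) {f} = trans (*-distribˡ-+ c (f x) _) (cong (c * f x +_) (*-distribˡ-∑ c xs))

∑-*-∑ : (xs : List A) (ys : List B) {f : A → ℕ} {g : B → ℕ} →
        ∑ xs f * ∑ ys g ≡ ∑ xs (λ x → ∑ ys (λ y → f x * g y))
∑-*-∑ []       ys         = refl
∑-*-∑ (x ∷ xs) ys {f} {g} =
  trans (*-distribʳ-+ (∑ ys g) (f x) (∑ xs f)) (cong₂ _+_ (*-distribˡ-∑ (f x) ys) (∑-*-∑ xs ys))

∑-allFin-suc : (f : Fin (suc n) → ℕ) → ∑ (allFin (suc n)) f ≡ f zero + ∑ (allFin n) (f ∘ suc)
∑-allFin-suc {n} f =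
  cong (f zero +_) (trans (cong (λ xs → ∑ xs f) (sym (map-tabulate id suc))) (∑-map suc (allFin n)))

∑-allFin-single : (s : Fin n) {f : Fin n → ℕ} → (∀ t → t ≢ s → f t ≡ 0) → ∑ (allFin n) f ≡ f s
∑-allFin-single {suc n} zero    {f} f≗0 = begin
  ∑ (allFin (suc n)) f             ≡⟨ ∑-allFin-suc f ⟩
  f zero + ∑ (allFin n) (f ∘ suc)  ≡⟨ cong (f zero +_) (∑-zero (allFin n) (λ t → f≗0 (suc t) λ ())) ⟩
  f zero + 0                       ≡⟨ +-identityʳ (f zero) ⟩
  f zero                           ∎
∑-allFin-single {suc n} (suc s) {f} f≗0 = begin
  ∑ (allFin (suc n)) f             ≡⟨ ∑-allFin-suc f ⟩
  f zero + ∑ (allFin n) (f ∘ suc)  ≡⟨ cong₂ _+_ (f≗0 zero λ ()) (∑-allFin-single s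
                                        (λ t t≢s → f≗0 (suc t) (t≢s ∘ suc-injective))) ⟩
  f (suc s)                        ∎

-- Multiplicities

⟦_⟧ : Bool → ℕ
⟦ b ⟧ = if b then 1 else 0

module _ {{_ : DecEq A}} where

  δ : A → A → ℕ
  δ x y = ⟦ does (x ≟ y) ⟧

  occ : A → List A → ℕ
  occ x xs = ∑ xs (λ a → δ a x)

  -- For blocks without repeated entries each factor is 0 or 1, so this is the number of blocks
  -- through both points. As a sum of products it can be expanded, swapped and reindexed.
  mult : List (List A) → A → A → ℕ
  mult 𝓑 x y = ∑ 𝓑 (λ L → occ x L * occ y L)

  δ-≡ : {x y : A} → x ≡ y → δ x y ≡ 1
  δ-≡ x≡y = cong ⟦_⟧ (dec-true (_ ≟ _) x≡y)

  δ-≢ : {x y : A} → x ≢ y → δ x y ≡ 0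
  δ-≢ x≢y = cong ⟦_⟧ (dec-false (_ ≟ _) x≢y)

  mult-comm : (𝓑 : List (List A)) (x y : A) → mult 𝓑 x y ≡ mult 𝓑 y x
  mult-comm 𝓑 x y = ∑-cong (λ L → *-comm (occ x L) (occ y L)) 𝓑

  occ-∉ : {x : A} {xs : List A} → x ∉ xs → occ x xs ≡ 0
  occ-∉ {xs = []}     _    = refl
  occ-∉ {xs = a ∷ xs} x∉xs = cong₂ _+_ (δ-≢ (x∉xs ∘ here ∘ sym)) (occ-∉ (x∉xs ∘ there))

  occ-∈ : {x : A} {xs : List A} → Unique xs → x ∈ xs → occ x xs ≡ 1
  occ-∈ (a∉xs ∷ _)   (here refl)   = cong₂ _+_ (δ-≡ refl) (occ-∉ (λ x∈xs → All.lookup a∉xs x∈xs refl))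
  occ-∈ (a∉xs ∷ !xs) (there x∈xs) = cong₂ _+_ (δ-≢ (All.lookup a∉xs x∈xs)) (occ-∈ !xs x∈xs)

module _ {{_ : DecEq A}} {{_ : DecEq B}} where

  δ-cong : {x y : A} {z w : B} → (x ≡ y → z ≡ w) → (z ≡ w → x ≡ y) → δ x y ≡ δ z w
  δ-cong {x} {y} to from with x ≟ y
  ... | yes x≡y = sym (δ-≡ (to x≡y))
  ... | no  x≢y = sym (δ-≢ (x≢y ∘ from))

  module _ {f : A → B} where

    occ-map : Injective _≡_ _≡_ f → (x : A) (xs : List A) → occ (f x) (map f xs) ≡ occ x xs
    occ-map f-inj x xs = trans (∑-map f xs) (∑-cong (λ a → sym (δ-cong (cong f) f-inj)) xs)

    occ-map-∉ : {y : B} → (∀ x → f x ≢ y) → (xs : List A) → occ y (map f xs) ≡ 0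
    occ-map-∉ fx≢y xs = trans (∑-map f xs) (∑-zero xs (λ x → δ-≢ (fx≢y x)))

    mult-map : Injective _≡_ _≡_ f → (𝓑 : List (List A)) (x y : A) →
               mult (map (map f) 𝓑) (f x) (f y) ≡ mult 𝓑 x y
    mult-map f-inj 𝓑 x y =
      trans (∑-map (map f) 𝓑) (∑-cong (λ L → cong₂ _*_ (occ-map f-inj x L) (occ-map f-inj y L)) 𝓑)

    mult-map-∉ˡ : {y : B} → (∀ x → f x ≢ y) → (𝓑 : List (List A)) (z : B) → mult (map (map f) 𝓑) y z ≡ 0
    mult-map-∉ˡ fx≢y 𝓑 z =
      trans (∑-map (map f) 𝓑) (∑-zero 𝓑 (λ L → cong (_* occ z (map f L)) (occ-map-∉ fx≢y L)))

    mult-map-∉ʳ : {z : B} → (∀ x → f x ≢ z) → (𝓑 : List (List A)) (y : B) → mult (map (map f) 𝓑) y z ≡ 0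
    mult-map-∉ʳ {z} fx≢z 𝓑 y = trans (mult-comm (map (map f) 𝓑) y z) (mult-map-∉ˡ fx≢z 𝓑 y)

∑-δ : (s : Fin n) {f : Fin n → ℕ} → ∑ (allFin n) (λ t → δ t s * f t) ≡ f s
∑-δ s {f} = begin
  ∑ (allFin _) (λ t → δ t s * f t)  ≡⟨ ∑-allFin-single s (λ t t≢s → cong (_* f t) (δ-≢ t≢s)) ⟩
  δ s s * f s                       ≡⟨ cong (_* f s) (δ-≡ {x = s} refl) ⟩
  f s + 0                           ≡⟨ +-identityʳ (f s) ⟩
  f s                               ∎

-- Block designs given by lists of points

IsBlock : ℕ → List A → Set
IsBlock k L = Unique L × length L ≡ k

map-isBlock : {f : A → B} → Injective _≡_ _≡_ f → {L : List A} → IsBlock k L → IsBlock k (map f L)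
map-isBlock {f = f} f-inj {L} (!L , ∣L∣≡k) = Unique.map⁺ f-inj !L , trans (length-map f L) ∣L∣≡k

-- Blocks are lists here, so that translating or embedding a block is a `map` and incidence counts
-- are sums over its entries; `IsBlock` makes each list represent a `k`-subset.
record ListDesign (v k l : ℕ) : Set where
  field
    blocks   : List (List (Fin v))
    isBlock  : All (IsBlock k) blocks
    balanced : ∀ {x y} → x ≢ y → mult blocks x y ≡ l

module _ {v : ℕ} where
  open DecMembership (_≟_ {A = Fin v}) using (_∈?_)

  toSubset : List (Fin v) → Subset.Subset v
  toSubset L = Vec.tabulate (λ x → does (x ∈? L))

  occ-unique : {x : Fin v} {L : List (Fin v)} → Unique L → occ x L ≡ ⟦ does (x ∈? L) ⟧
  occ-unique {x} {L} !L with x ∈? L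
  ... | yes x∈L = occ-∈ !L x∈L
  ... | no  x∉L = occ-∉ x∉L

does-∈? : (x : Fin n) (p : Subset.Subset n) → does (x Subset.∈? p) ≡ Vec.lookup p x
does-∈? zero    (true  Vec.∷ p) = refl
does-∈? zero    (false Vec.∷ p) = refl
does-∈? (suc x) (s     Vec.∷ p) = does-∈? x p

∣tabulate∣ : (f : Fin n → Bool) → Subset.∣ Vec.tabulate f ∣ ≡ ∑ (allFin n) (⟦_⟧ ∘ f)
∣tabulate∣ {zero}  f = refl
∣tabulate∣ {suc n} f = trans head (sym (∑-allFin-suc (⟦_⟧ ∘ f)))
  where
  head : Subset.∣ Vec.tabulate f ∣ ≡ ⟦ f zero ⟧ + ∑ (allFin n) (⟦_⟧ ∘ f ∘ suc)
  head with f zero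
  ... | true  = cong suc (∣tabulate∣ (f ∘ suc))
  ... | false = ∣tabulate∣ (f ∘ suc)

∣toSubset∣ : {L : List (Fin v)} → Unique L → Subset.∣ toSubset L ∣ ≡ length L
∣toSubset∣ {v} {L} !L = begin
  Subset.∣ toSubset L ∣                   ≡⟨ ∣tabulate∣ {v} _ ⟩
  ∑ (allFin v) _                          ≡⟨ ∑-cong (λ x → occ-unique {x = x} !L) (allFin v) ⟨
  -- Double counting: with the sums exchanged, each entry of `L` is matched by exactly one point.
  ∑ (allFin v) (λ x → occ x L)            ≡⟨ ∑-swap (allFin v) L ⟩
  ∑ L (λ a → ∑ (allFin v) (λ x → δ a x))  ≡⟨ ∑-cong (λ a → ∑-allFin-single a (λ x x≢a → δ-≢ (x≢a ∘ sym))) L ⟩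
  ∑ L (λ a → δ a a)                       ≡⟨ ∑-cong (λ a → δ-≡ {x = a} refl) L ⟩
  ∑ L (const 1)                           ≡⟨ ∑-const-1 L ⟩
  length L                                ∎

⟦∧⟧ : (b c : Bool) → ⟦ b ∧ c ⟧ ≡ ⟦ b ⟧ * ⟦ c ⟧
⟦∧⟧ false _ = refl
⟦∧⟧ true  c = sym (+-identityʳ ⟦ c ⟧)

length-filter-∷ : {P : A → Set} (P? : Decidable P) (x : A) (xs : List A) →
                  length (filter P? (x ∷ xs)) ≡ ⟦ does (P? x) ⟧ + length (filter P? xs)
length-filter-∷ P? x xs with does (P? x)
... | false = refl
... | true  = refl

-- Distinctness of the entries turns `occ` into the indicator of membership, and the indicator of a
-- conjunction is a product of indicators.
pairCount-toSubset : {𝓑 : List (List (Fin v))} → All (IsBlock k) 𝓑 → (x y : Fin v) →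
                     pairCount (map toSubset 𝓑) x y ≡ mult 𝓑 x y
pairCount-toSubset []                               x y = refl
pairCount-toSubset {𝓑 = L ∷ 𝓑} ((!L , _) ∷ isBlock) x y = begin
  pairCount (map toSubset (L ∷ 𝓑)) x y
    ≡⟨ length-filter-∷ _ (toSubset L) (map toSubset 𝓑) ⟩
  ⟦ x ∈ᵇL ∧ y ∈ᵇL ⟧ + pairCount (map toSubset 𝓑) x y
    ≡⟨ cong₂ _+_ (⟦∧⟧ (x ∈ᵇL) (y ∈ᵇL)) (pairCount-toSubset isBlock x y) ⟩
  ⟦ x ∈ᵇL ⟧ * ⟦ y ∈ᵇL ⟧ + mult 𝓑 x y
    ≡⟨ cong (_+ mult 𝓑 x y) (cong₂ _*_ (⟦∈⟧ x) (⟦∈⟧ y)) ⟩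
  occ x L * occ y L + mult 𝓑 x y
    ∎
  where
  _∈ᵇL : Fin _ → Bool
  z ∈ᵇL = does (z Subset.∈? toSubset L)

  ⟦∈⟧ : ∀ z → ⟦ z ∈ᵇL ⟧ ≡ occ z L
  ⟦∈⟧ z =
    trans (cong ⟦_⟧ (trans (does-∈? z (toSubset L)) (Vec.lookup∘tabulate _ z))) (sym (occ-unique !L))

toDesign2 : ListDesign v k l → Design2 v k l
toDesign2 D = record
  { blocks    = map toSubset blocks
  ; blockSize = All.map⁺ (All.map (λ (!L , ∣L∣≡k) → trans (∣toSubset∣ !L) ∣L∣≡k) isBlock)
  ; balanced  = λ x y x≢y → trans (pairCount-toSubset isBlock x y) (balanced x≢y)
  }
  where open ListDesign D

-- Translates of base blocks

module Translates
  {_∙_ : Fin n → Fin n → Fin n} {ε _⁻¹} (isAbelianGroup : IsAbelianGroup _≡_ _∙_ ε _⁻¹)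
  where

  private
    G : AbelianGroup _ _
    G = record { isAbelianGroup = isAbelianGroup }

  open AbelianGroup G using (_-_; comm; assoc; group)
  open AbelianGroupProperties G using (xyx⁻¹≈y)
  open GroupProperties group using (∙-cancelʳ; //-rightDividesˡ)

  -- One translate is listed for every group element, even if two coincide as sets, so counts agree
  -- with differences without a separate treatment of short orbits.
  orbit : List (Fin n) → List (List (Fin n))
  orbit B = map (λ t → map (_∙ t) B) (allFin n)

  ∂ : List (Fin n) → List (Fin n)
  ∂ B = concatMap (λ a → map (a -_) B) B

  translates : List (List (Fin n)) → List (List (Fin n))
  translates = concatMap orbit

  differences : List (List (Fin n)) → List (Fin n)
  differences = concatMap ∂

  translates-isBlock : {𝓑 : List (List (Fin n))} → All (IsBlock k) 𝓑 → All (IsBlock k) (translates 𝓑)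
  translates-isBlock {k} isBlock = All.concat⁺ (All.gmap⁺ orbit-isBlock isBlock)
    where
    orbit-isBlock : ∀ {B} → IsBlock k B → All (IsBlock k) (orbit B)
    orbit-isBlock B = All.map⁺ (All.universal (λ t → map-isBlock (∙-cancelʳ t _ _) B) (allFin n))

  ∙≡⇒≡- : ∀ {a t x} → a ∙ t ≡ x → t ≡ x - a
  ∙≡⇒≡- {a} {t} refl = sym (xyx⁻¹≈y a t)

  ≡-⇒∙≡ : ∀ {a t x} → t ≡ x - a → a ∙ t ≡ x
  ≡-⇒∙≡ {a} {x = x} refl = trans (comm a (x - a)) (//-rightDividesˡ a x)

  [a-b]∙[b∙d]≡a∙d : ∀ a b d → (a - b) ∙ (b ∙ d) ≡ a ∙ d
  [a-b]∙[b∙d]≡a∙d a b d = trans (sym (assoc (a - b) b d)) (cong (_∙ d) (//-rightDividesˡ b a))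

  -- Composing both sides with `b ∙ d` clears the two inverses; the converse below cancels the same
  -- element.
  -≡-⇒∙≡∙ : ∀ {a b c d} → a - b ≡ c - d → a ∙ d ≡ c ∙ b
  -≡-⇒∙≡∙ {a} {b} {c} {d} a-b≡c-d = begin
    a ∙ d              ≡⟨ [a-b]∙[b∙d]≡a∙d a b d ⟨
    (a - b) ∙ (b ∙ d)  ≡⟨ cong₂ _∙_ a-b≡c-d (comm b d) ⟩
    (c - d) ∙ (d ∙ b)  ≡⟨ [a-b]∙[b∙d]≡a∙d c d b ⟩
    c ∙ b              ∎

  ∙≡∙⇒-≡- : ∀ {a b c d} → a ∙ d ≡ c ∙ b → a - b ≡ c - d
  ∙≡∙⇒-≡- {a} {b} {c} {d} ad≡cb = ∙-cancelʳ (b ∙ d) (a - b) (c - d) (begin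
    (a - b) ∙ (b ∙ d)  ≡⟨ [a-b]∙[b∙d]≡a∙d a b d ⟩
    a ∙ d              ≡⟨ ad≡cb ⟩
    c ∙ b              ≡⟨ [a-b]∙[b∙d]≡a∙d c d b ⟨
    (c - d) ∙ (d ∙ b)  ≡⟨ cong ((c - d) ∙_) (comm d b) ⟩
    (c - d) ∙ (b ∙ d)  ∎)

  -- Both equations amount to `a ∙ y ≡ x ∙ b`.
  δ-translate : ∀ a b x y → δ (b ∙ (x - a)) y ≡ δ (a - b) (x - y)
  δ-translate a b x y = δ-cong
    (λ e → ∙≡∙⇒-≡- {a} {b} {x} {y} (trans (comm a y) (sym (-≡-⇒∙≡∙ (∙≡⇒≡- e)))))
    (λ e → ≡-⇒∙≡ (∙≡∙⇒-≡- {x} {a} {y} {b} (trans (sym (-≡-⇒∙≡∙ e)) (comm a y))))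

  -- The method of differences: expand both counts over entries `a`, `b` of `B` and move the sum
  -- over translates inside. Only `t = x - a` sends `a` to `x`, and it sends `b` to `y` exactly when
  -- `a - b ≡ x - y`.
  mult-orbit : (B : List (Fin n)) (x y : Fin n) → mult (orbit B) x y ≡ occ (x - y) (∂ B)
  mult-orbit B x y = begin
    mult (orbit B) x y
      ≡⟨ ∑-map (λ t → map (_∙ t) B) (allFin n) ⟩
    ∑ (allFin n) (λ t → occ x (map (_∙ t) B) * occ y (map (_∙ t) B))
      ≡⟨ ∑-cong (λ t → cong₂ _*_ (∑-map (_∙ t) B) (∑-map (_∙ t) B)) (allFin n) ⟩
    ∑ (allFin n) (λ t → ∑ B (λ a → δ (a ∙ t) x) * ∑ B (λ b → δ (b ∙ t) y))
      ≡⟨ ∑-cong (λ t → ∑-*-∑ B B) (allFin n) ⟩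
    ∑ (allFin n) (λ t → ∑ B (λ a → ∑ B (λ b → δ (a ∙ t) x * δ (b ∙ t) y)))
      ≡⟨ ∑-swap (allFin n) B ⟩
    ∑ B (λ a → ∑ (allFin n) (λ t → ∑ B (λ b → δ (a ∙ t) x * δ (b ∙ t) y)))
      ≡⟨ ∑-cong (λ a → trans (∑-swap (allFin n) B) (∑-cong (∑-translates a) B)) B ⟩
    ∑ B (λ a → ∑ B (λ b → δ (a - b) (x - y)))
      ≡⟨ ∑-cong (λ a → ∑-map (a -_) B) B ⟨
    ∑ B (λ a → occ (x - y) (map (a -_) B))
      ≡⟨ ∑-concatMap (λ a → map (a -_) B) B ⟨
    occ (x - y) (∂ B)
      ∎
    where
    ∑-translates : ∀ a b → ∑ (allFin n) (λ t → δ (a ∙ t) x * δ (b ∙ t) y) ≡ δ (a - b) (x - y)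
    ∑-translates a b = begin
      ∑ (allFin n) (λ t → δ (a ∙ t) x * δ (b ∙ t) y)
        ≡⟨ ∑-cong (λ t → cong (_* δ (b ∙ t) y) (δ-cong ∙≡⇒≡- ≡-⇒∙≡)) (allFin n) ⟩
      ∑ (allFin n) (λ t → δ t (x - a) * δ (b ∙ t) y)
        ≡⟨ ∑-δ (x - a) ⟩
      δ (b ∙ (x - a)) y
        ≡⟨ δ-translate a b x y ⟩
      δ (a - b) (x - y)
        ∎

  mult-translates : (𝓑 : List (List (Fin n))) (x y : Fin n) →
                    mult (translates 𝓑) x y ≡ occ (x - y) (differences 𝓑)
  mult-translates 𝓑 x y = begin
    mult (translates 𝓑) x y          ≡⟨ ∑-concatMap orbit 𝓑 ⟩
    ∑ 𝓑 (λ B → mult (orbit B) x y)   ≡⟨ ∑-cong (λ B → mult-orbit B x y) 𝓑 ⟩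
    ∑ 𝓑 (λ B → occ (x - y) (∂ B))    ≡⟨ ∑-concatMap ∂ 𝓑 ⟨
    occ (x - y) (differences 𝓑)      ∎

-- Cyclic groups

%-absorbˡ : ∀ i j m .{{_ : NonZero m}} → (i % m + j) % m ≡ (i + j) % m
%-absorbˡ i j m = begin
  (i % m + j) % m          ≡⟨ %-distribˡ-+ (i % m) j m ⟩
  (i % m % m + j % m) % m  ≡⟨ cong (λ r → (r + j % m) % m) (m%n%n≡m%n i m) ⟩
  (i % m + j % m) % m      ≡⟨ %-distribˡ-+ i j m ⟨
  (i + j) % m              ∎

toℕ-mod : ∀ i m .{{_ : NonZero m}} → toℕ (i mod m) ≡ i % m
toℕ-mod i m = toℕ-fromℕ< (m%n<n i m)

toℕ-% : ∀ {m} .{{_ : NonZero m}} (i : Fin m) → toℕ i % m ≡ toℕ i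
toℕ-% i = m<n⇒m%n≡m (toℕ<n i)

module Cyclic (m : ℕ) where

  private
    N : ℕ
    N = suc m

  infixl 6 _⊕_
  _⊕_ : Fin N → Fin N → Fin N
  i ⊕ j = (toℕ i + toℕ j) mod N

  -- Multiplication by m = N − 1 is negation modulo N.
  ⊖_ : Fin N → Fin N
  ⊖ i = (m * toℕ i) mod N

  ⊕-comm : ∀ i j → i ⊕ j ≡ j ⊕ i
  ⊕-comm i j = cong (_mod N) (+-comm (toℕ i) (toℕ j))

  toℕ-⊕-⊕ : ∀ i j k → toℕ (i ⊕ j ⊕ k) ≡ (toℕ i + toℕ j + toℕ k) % N
  toℕ-⊕-⊕ i j k = begin
    toℕ (i ⊕ j ⊕ k)                      ≡⟨ toℕ-mod (toℕ (i ⊕ j) + toℕ k) N ⟩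
    (toℕ (i ⊕ j) + toℕ k) % N            ≡⟨ cong (λ r → (r + toℕ k) % N) (toℕ-mod (toℕ i + toℕ j) N) ⟩
    ((toℕ i + toℕ j) % N + toℕ k) % N    ≡⟨ %-absorbˡ (toℕ i + toℕ j) (toℕ k) N ⟩
    (toℕ i + toℕ j + toℕ k) % N          ∎

  ⊕-assoc : ∀ i j k → i ⊕ j ⊕ k ≡ i ⊕ (j ⊕ k)
  ⊕-assoc i j k = toℕ-injective (begin
    toℕ (i ⊕ j ⊕ k)                ≡⟨ toℕ-⊕-⊕ i j k ⟩
    (toℕ i + toℕ j + toℕ k) % N    ≡⟨ cong (_% N) (+-assoc (toℕ i) _ _) ⟩
    (toℕ i + (toℕ j + toℕ k)) % N  ≡⟨ cong (_% N) (+-comm (toℕ i) _) ⟩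
    (toℕ j + toℕ k + toℕ i) % N    ≡⟨ toℕ-⊕-⊕ j k i ⟨
    toℕ (j ⊕ k ⊕ i)                ≡⟨ cong toℕ (⊕-comm (j ⊕ k) i) ⟩
    toℕ (i ⊕ (j ⊕ k))              ∎)

  ⊕-identityˡ : ∀ i → zero ⊕ i ≡ i
  ⊕-identityˡ i = toℕ-injective (trans (toℕ-mod (toℕ i) N) (toℕ-% i))

  ⊕-inverseˡ : ∀ i → (⊖ i) ⊕ i ≡ zero
  ⊕-inverseˡ i = toℕ-injective (begin
    toℕ ((⊖ i) ⊕ i)                ≡⟨ toℕ-mod (toℕ (⊖ i) + toℕ i) N ⟩
    (toℕ (⊖ i) + toℕ i) % N        ≡⟨ cong (λ r → (r + toℕ i) % N) (toℕ-mod (m * toℕ i) N) ⟩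
    ((m * toℕ i) % N + toℕ i) % N  ≡⟨ %-absorbˡ (m * toℕ i) (toℕ i) N ⟩
    (m * toℕ i + toℕ i) % N        ≡⟨ cong (_% N) (trans (+-comm (m * toℕ i) _) (*-comm N (toℕ i))) ⟩
    (toℕ i * N) % N                ≡⟨ m*n%n≡0 (toℕ i) N ⟩
    0                              ∎)

  isAbelianGroup : IsAbelianGroup _≡_ _⊕_ zero ⊖_
  isAbelianGroup = record
    { isGroup = record
      { isMonoid = record
        { isSemigroup = record
          { isMagma = record { isEquivalence = isEquivalence ; ∙-cong = cong₂ _⊕_ }
          ; assoc   = ⊕-assoc
          }
        ; identity = ⊕-identityˡ , λ i → trans (⊕-comm i zero) (⊕-identityˡ i)
        }
      ; inverse = ⊕-inverseˡ , λ i → trans (⊕-comm i (⊖ i)) (⊕-inverseˡ i)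
      ; ⁻¹-cong = cong ⊖_
      }
    ; comm = ⊕-comm
    }

  open Translates isAbelianGroup public

  abelianGroup : AbelianGroup _ _
  abelianGroup = record { isAbelianGroup = isAbelianGroup }

  open AbelianGroup abelianGroup public using (_-_; group)
  open GroupProperties group using (x∙y⁻¹≈ε⇒x≈y; //-rightDividesˡ)

  module _ {g : ℕ} .{{_ : NonZero g}} (g∣n : g ∣ suc m) where

    toℕ-⊕-% : ∀ i j → toℕ (i ⊕ j) % g ≡ (toℕ i + toℕ j) % g
    toℕ-⊕-% i j = trans (cong (_% g) (toℕ-mod (toℕ i + toℕ j) N)) (m∣n⇒o%n%m≡o%m g N (toℕ i + toℕ j) g∣n)

    [i-j]+j≡i-% : ∀ i j → (toℕ (i - j) + toℕ j) % g ≡ toℕ i % g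
    [i-j]+j≡i-% i j = trans (sym (toℕ-⊕-% (i - j) j)) (cong (λ x → toℕ x % g) (//-rightDividesˡ j i))

    ≡%⇒-%≡0 : ∀ i j → toℕ i % g ≡ toℕ j % g → toℕ (i - j) % g ≡ 0
    ≡%⇒-%≡0 i j i≡j = begin
      -- Subtraction is avoided by adding `N * toℕ j`, a multiple of `g`. One of its copies of `j`
      -- turns `d` into `i` modulo `g`; replacing `i` by `j` then restores the full multiple.
      d % g                              ≡⟨ %-remove-+ʳ d (∣m⇒∣m*n (toℕ j) g∣n) ⟨
      (d + N * toℕ j) % g                ≡⟨ cong (_% g) (+-assoc d (toℕ j) _) ⟨
      (d + toℕ j + m * toℕ j) % g        ≡⟨ %-absorbˡ (d + toℕ j) _ g ⟨
      ((d + toℕ j) % g + m * toℕ j) % g  ≡⟨ cong (λ r → (r + m * toℕ j) % g) (trans ([i-j]+j≡i-% i j) i≡j) ⟩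
      (toℕ j % g + m * toℕ j) % g        ≡⟨ %-absorbˡ (toℕ j) _ g ⟩
      (N * toℕ j) % g                    ≡⟨ %-remove-+ʳ 0 (∣m⇒∣m*n (toℕ j) g∣n) ⟩
      0 % g                              ≡⟨ m*n%n≡0 0 g ⟩
      0                                  ∎
      where d = toℕ (i - j)

    -%≡0⇒≡% : ∀ i j → toℕ (i - j) % g ≡ 0 → toℕ i % g ≡ toℕ j % g
    -%≡0⇒≡% i j d≡0 = begin
      toℕ i % g                      ≡⟨ [i-j]+j≡i-% i j ⟨
      (toℕ (i - j) + toℕ j) % g      ≡⟨ %-absorbˡ (toℕ (i - j)) (toℕ j) g ⟨
      (toℕ (i - j) % g + toℕ j) % g  ≡⟨ cong (λ r → (r + toℕ j) % g) d≡0 ⟩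
      toℕ j % g                      ∎

  -- The diagonal terms `a - a` of `∂` contribute only to zero, so just the values 1 to `m` are
  -- tested. Differences are compared as natural numbers, whose equality test runs on primitive
  -- arithmetic.
  CoversDifferences : List (List (Fin (suc m))) → (ℕ → ℕ) → Set
  CoversDifferences 𝓑 c = All (λ d → occ (suc d) (map toℕ (differences 𝓑)) ≡ c (suc d)) (upTo m)

  mult-translates-≢ : ∀ 𝓑 c → CoversDifferences 𝓑 c → ∀ {x y} → x ≢ y →
                      mult (translates 𝓑) x y ≡ c (toℕ (x - y))
  mult-translates-≢ 𝓑 c covers {x} {y} x≢y =
    trans (mult-translates 𝓑 x y) (occ-differences (x≢y ∘ x∙y⁻¹≈ε⇒x≈y x y))
    where
    occ-differences : ∀ {d} → d ≢ zero → occ d (differences 𝓑) ≡ c (toℕ d)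
    occ-differences {zero}  d≢0 = contradiction refl d≢0
    occ-differences {suc d} _   =
      trans (sym (occ-map toℕ-injective (suc d) (differences 𝓑))) (All.lookup covers (∈-upTo⁺ (toℕ<n d)))

  coversDifferences? : ∀ 𝓑 c → Dec (CoversDifferences 𝓑 c)
  coversDifferences? 𝓑 c = counts? (map toℕ (differences 𝓑))
    where
    -- Abstracting over the list of differences has it evaluated only once.
    counts? : ∀ ds → Dec (All (λ d → occ (suc d) ds ≡ c (suc d)) (upTo m))
    counts? ds = all? (λ d → occ (suc d) ds ≟ c (suc d)) (upTo m)

  cyclicDesign : (𝓑 : List (List (Fin (suc m)))) → All (IsBlock k) 𝓑 → CoversDifferences 𝓑 (const l) →
                 ListDesign (suc m) k l
  cyclicDesign 𝓑 isBlock covers = record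
    { blocks   = translates 𝓑
    ; isBlock  = translates-isBlock isBlock
    ; balanced = mult-translates-≢ 𝓑 (const _) covers
    }

-- Filling in the groups of a group divisible design

-- The groups of the design are the sets of points combine j i with i fixed.
record GroupDivisibleDesign (m g k l : ℕ) : Set where
  field
    blocks     : List (List (Fin (m * g)))
    isBlock    : All (IsBlock k) blocks
    within     : ∀ {j j'} (i : Fin g) → j ≢ j' → mult blocks (combine {m} j i) (combine j' i) ≡ 0
    transverse : ∀ (j j' : Fin m) {i i' : Fin g} → i ≢ i' → mult blocks (combine j i) (combine j' i') ≡ l

-- The point `combine j i` is the number `g * j + i`, so the groups are the residue classes modulo
-- `g`, that is, the cosets of the subgroup of multiples of `g`.
toℕ-combine-% : ∀ {m g} .{{_ : NonZero g}} (j : Fin m) (i : Fin g) → toℕ (combine j i) % g ≡ toℕ i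
toℕ-combine-% {g = g} j i = begin
  toℕ (combine j i) % g      ≡⟨ cong (_% g) (toℕ-combine j i) ⟩
  (g * toℕ j + toℕ i) % g    ≡⟨ %-remove-+ˡ (toℕ i) (m∣m*n (toℕ j)) ⟩
  toℕ i % g                  ≡⟨ toℕ-% i ⟩
  toℕ i                      ∎

-- The difference counts of a relative difference family, with the multiples of `g` as the forbidden
-- subgroup.
relative : (g l : ℕ) .{{_ : NonZero g}} → ℕ → ℕ
relative g l d = if does (d % g ≟ 0) then 0 else l

module _ (g l d : ℕ) .{{_ : NonZero g}} where

  relative-≡0 : d % g ≡ 0 → relative g l d ≡ 0
  relative-≡0 d≡0 = cong (λ b → if b then 0 else l) (dec-true (d % g ≟ 0) d≡0)

  relative-≢0 : d % g ≢ 0 → relative g l d ≡ l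
  relative-≢0 d≢0 = cong (λ b → if b then 0 else l) (dec-false (d % g ≟ 0) d≢0)

module _ (q h : ℕ) where

  private
    g = suc h
    -- `suc q * g` reduces to `suc (h + q * g)`, so the points of the group divisible design are the
    -- elements of this cyclic group by computation.
    module ℤₙ = Cyclic (h + q * g)

    g∣n : g ∣ suc q * g
    g∣n = divides (suc q) refl

  open ℤₙ using (_-_)

  -- Two points share a group exactly when `g` divides their difference, and that difference alone
  -- determines how many translates contain both.
  cyclicGDD : (𝓑 : List (List (Fin (suc q * g)))) → All (IsBlock k) 𝓑 →
              ℤₙ.CoversDifferences 𝓑 (relative g l) → GroupDivisibleDesign (suc q) g k l
  cyclicGDD {l = l} 𝓑 isBlock covers = record
    { blocks     = ℤₙ.translates 𝓑
    ; isBlock    = ℤₙ.translates-isBlock isBlock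
    ; within     = λ {j} {j'} i j≢j' → trans
        (ℤₙ.mult-translates-≢ 𝓑 (relative g l) covers (j≢j' ∘ combine-injectiveˡ j i j' i))
        (relative-≡0 g l (toℕ (combine j i - combine j' i)) (ℤₙ.≡%⇒-%≡0 g∣n (combine j i) (combine j' i)
          (trans (toℕ-combine-% j i) (sym (toℕ-combine-% j' i)))))
    ; transverse = λ j j' {i} {i'} i≢i' → trans
        (ℤₙ.mult-translates-≢ 𝓑 (relative g l) covers (i≢i' ∘ combine-injectiveʳ j i j' i'))
        (relative-≢0 g l (toℕ (combine j i - combine j' i')) (λ d≡0 → i≢i' (toℕ-injective (begin
          toℕ i                    ≡⟨ toℕ-combine-% j i ⟨
          toℕ (combine j i) % g    ≡⟨ ℤₙ.-%≡0⇒≡% g∣n (combine j i) (combine j' i') d≡0 ⟩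
          toℕ (combine j' i') % g  ≡⟨ toℕ-combine-% j' i' ⟩
          toℕ i'                   ∎))))
    }

module Fill {m g} (𝓖 : GroupDivisibleDesign m g k l) (𝓓 : ListDesign (suc m) k l) where

  private
    module 𝓖 = GroupDivisibleDesign 𝓖
    module 𝓓 = ListDesign 𝓓

  -- `zero` is the point ∞ shared by all copies; `suc` shifts the points of the group divisible
  -- design past it.
  embed : Fin g → Fin (suc m) → Fin (suc (m * g))
  embed i zero    = zero
  embed i (suc j) = suc (combine j i)

  embed-injective : ∀ i → Injective _≡_ _≡_ (embed i)
  embed-injective i {zero}  {zero}   _ = refl
  embed-injective i {suc j} {suc j'} e = cong suc (combine-injectiveˡ j i j' i (suc-injective e))

  -- Different copies meet only in ∞, so a pair with a finite point lies in the point set of at most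
  -- one copy.
  embed-≢ : ∀ {i i' j} → i' ≢ i → ∀ x → embed i' x ≢ embed i (suc j)
  embed-≢ {i} {i'} {j} i'≢i (suc j') e = i'≢i (combine-injectiveʳ j' i' j i (suc-injective e))

  transversals : List (List (Fin (suc (m * g))))
  transversals = map (map suc) 𝓖.blocks

  copy : Fin g → List (List (Fin (suc (m * g))))
  copy i = map (map (embed i)) 𝓓.blocks

  blocks : List (List (Fin (suc (m * g))))
  blocks = transversals ++ concatMap copy (allFin g)

  isBlock : All (IsBlock k) blocks
  isBlock = All.++⁺
    (All.gmap⁺ (map-isBlock suc-injective) 𝓖.isBlock)
    (All.concat⁺ (All.map⁺ (All.universal copy-isBlock (allFin g))))
    where
    copy-isBlock : ∀ i → All (IsBlock k) (copy i)
    copy-isBlock i = All.gmap⁺ (map-isBlock (embed-injective i)) 𝓓.isBlock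

  mult-blocks : ∀ x y → mult blocks x y ≡ mult transversals x y + ∑ (allFin g) (λ i → mult (copy i) x y)
  mult-blocks x y =
    trans (∑-++ transversals _) (cong (mult transversals x y +_) (∑-concatMap copy (allFin g)))

  ∑-copies : ∀ {i a b} → a ≢ b → (∀ i' → i' ≢ i → mult (copy i') (embed i a) (embed i b) ≡ 0) →
             ∑ (allFin g) (λ i' → mult (copy i') (embed i a) (embed i b)) ≡ l
  ∑-copies {i} {a} {b} a≢b others =
    trans (∑-allFin-single i others) (trans (mult-map (embed-injective i) 𝓓.blocks a b) (𝓓.balanced a≢b))

  -- No transversal block contains ∞, and `q` lies in a single group, whose copy alone supplies the
  -- `l` blocks.
  balanced-∞ : ∀ q → mult blocks zero (suc q) ≡ l
  balanced-∞ q with j , i , refl ← combine-surjective {m} {g} q = begin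
    mult blocks zero (suc q)  ≡⟨ mult-blocks zero (suc q) ⟩
    _                         ≡⟨ cong₂ _+_ (mult-map-∉ˡ (λ _ ()) 𝓖.blocks (suc q)) (∑-copies {i} (λ ()) no-copy) ⟩
    l                         ∎
    where
    no-copy : ∀ h → h ≢ i → mult (copy h) zero (suc q) ≡ 0
    no-copy h h≢i = mult-map-∉ʳ (embed-≢ h≢i) 𝓓.blocks zero

  -- For two finite points exactly one source contributes: the copy on their common group, or the
  -- transversal blocks if their groups differ.
  balanced : ∀ {x y} → x ≢ y → mult blocks x y ≡ l
  balanced {zero}  {zero}  x≢y = contradiction refl x≢y
  balanced {zero}  {suc q} _   = balanced-∞ q
  balanced {suc p} {zero}  _   = trans (mult-comm blocks (suc p) zero) (balanced-∞ p)
  balanced {suc p} {suc q} x≢y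
    with j , i , refl ← combine-surjective {m} {g} p | j' , i' , refl ← combine-surjective {m} {g} q
    with i ≟ i'
  ... | yes refl = begin
    mult blocks (suc p) (suc q)  ≡⟨ mult-blocks (suc p) (suc q) ⟩
    _                            ≡⟨ cong₂ _+_ in-𝓖 (∑-copies (j≢j' ∘ suc-injective) no-copy) ⟩
    l                            ∎
    where
    j≢j' : j ≢ j'
    j≢j' refl = x≢y refl

    in-𝓖 : mult transversals (suc p) (suc q) ≡ 0
    in-𝓖 = trans (mult-map suc-injective 𝓖.blocks p q) (𝓖.within i j≢j')

    no-copy : ∀ h → h ≢ i → mult (copy h) (suc p) (suc q) ≡ 0
    no-copy h h≢i = mult-map-∉ˡ (embed-≢ h≢i) 𝓓.blocks (suc q)
  ... | no i≢i' = begin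
    mult blocks (suc p) (suc q)  ≡⟨ mult-blocks (suc p) (suc q) ⟩
    _                            ≡⟨ cong₂ _+_ in-𝓖 (∑-zero (allFin g) no-copy) ⟩
    l + 0                        ≡⟨ +-identityʳ l ⟩
    l                            ∎
    where
    in-𝓖 : mult transversals (suc p) (suc q) ≡ l
    in-𝓖 = trans (mult-map suc-injective 𝓖.blocks p q) (𝓖.transverse j j' i≢i')

    no-copy : ∀ h → mult (copy h) (suc p) (suc q) ≡ 0
    -- A copy contains the finite points of one group only: the copy on group `i` misses `q`, every
    -- other copy misses `p`.
    no-copy h with h ≟ i
    ... | yes refl = mult-map-∉ʳ (embed-≢ i≢i') 𝓓.blocks (suc p)
    ... | no  h≢i  = mult-map-∉ˡ (embed-≢ h≢i) 𝓓.blocks (suc q)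

  design : ListDesign (suc (m * g)) k l
  design = record { blocks = blocks ; isBlock = isBlock ; balanced = balanced }

-- The design

module ℤ₆₄ = Cyclic 63
module ℤ₆₉₃ = Cyclic 692

isBlock? : (k : ℕ) (L : List (Fin n)) → Dec (IsBlock k L)
isBlock? k L = unique? _≟_ L ×-dec (length L ≟ k)

-- A cyclic difference family: three blocks give 3 · 42 = 126 = 2 · 63 differences of distinct
-- points, every nonzero residue twice.
baseBlocks₆₄ : List (List (Fin 64))
baseBlocks₆₄ = map (map (_mod 64))
  ( (0 ∷ 4 ∷ 16 ∷ 19 ∷ 30 ∷ 36 ∷ 43 ∷ [])
  ∷ (0 ∷ 1 ∷ 10 ∷ 15 ∷ 23 ∷ 41 ∷ 43 ∷ [])
  ∷ (0 ∷ 2 ∷ 3 ∷ 8 ∷ 12 ∷ 19 ∷ 37 ∷ [])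
  ∷ [])

design₆₄ : ListDesign 64 7 2
design₆₄ = ℤ₆₄.cyclicDesign baseBlocks₆₄
  (from-yes (all? (isBlock? 7) baseBlocks₆₄))
  (from-yes (ℤ₆₄.coversDifferences? baseBlocks₆₄ (const 2)))

-- Here 3 · 42 = 126 differences between distinct positions cover all 63 residues twice. The
-- repeated 0 in the first multiset supplies the difference zero, once in each order.
multisets₆₃ : List (List ℕ)
multisets₆₃ =
    (0 ∷ 0 ∷ 14 ∷ 15 ∷ 27 ∷ 33 ∷ 40 ∷ [])
  ∷ (0 ∷ 3 ∷ 5 ∷ 8 ∷ 24 ∷ 25 ∷ 34 ∷ [])
  ∷ (0 ∷ 4 ∷ 10 ∷ 12 ∷ 21 ∷ 28 ∷ 32 ∷ [])
  ∷ []

-- By the Chinese remainder theorem 441 i + 253 b is i modulo 11 and b modulo 63.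
baseBlocks₆₉₃ : List (List (Fin 693))
baseBlocks₆₉₃ = concatMap
  (λ u → map (zipWith (λ i b → (441 * (suc u * i) + 253 * b) mod 693) (upTo 7)) multisets₆₃)
  (upTo 10)

gdd₆₉₃ : GroupDivisibleDesign 63 11 7 2
-- The arguments are one less than the group size 63 and the number 11 of groups.
gdd₆₉₃ = cyclicGDD 62 10 baseBlocks₆₉₃
  -- The points of a block are distinct even where a multiset repeats, since the first coordinates
  -- `u·i` with `0 ≤ i ≤ 6` are distinct modulo 11.
  (from-yes (all? (isBlock? 7) baseBlocks₆₉₃))
  -- The 30 blocks have 30 · 42 = 1260 = 2 · (693 - 63) differences of distinct points, none of them
  -- a multiple of 11.
  (from-yes (ℤ₆₉₃.coversDifferences? baseBlocks₆₉₃ (relative 11 2)))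

theorem2p4 : Design2 694 7 2
theorem2p4 = toDesign2 (Fill.design gdd₆₉₃ design₆₄)
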